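{- For all $d\ge 1$ and all $r\in V(Q^d)$ we have $z_{Q^d,r}<2\pi(Q^d,r)$.
   Context: $Q^d$ is the $d$-dimensional hypercube graph (vertices: subsets of $\{1,\dots,d\}$, adjacent when they differ in exactly one element). A configuration on a connected graph $G$ is a function $C:V(G)\to\mathbb{N}$; a pebbling step from $u$ to a neighbor $v$ removes two pebbles from $u$ and adds one to $v$; $C$ is $r$-solvable if some sequence of pebbling steps places a pebble on $r$. $\pi(G,r)$ is the minimum $t$ such that every configuration with $t$ pebbles in total is $r$-solvable. A strategy rooted at $r$ is a subtree $T$ of $G$ containing $r$ with at least two vertices, rooted at $r$ ($v^+$ = parent of $v$), with a nonnegative, not identically zero weight function $w$ on $V(G)$ such that $w(r)=0$, $w(v)=0$ off $T$, and $w(v^+)=2w(v)$ for every $v\in V(T)\setminus\{r\}$ whose parent is not $r$. Write $w(C)=\sum_v w(v)C(v)$ and $w(\mathbf{T})=\sum_{v\in V(T)}w(v)$. $z_{G,r}$ is the optimal value of the integer optimization problem: maximize $\sum_{v\neq r}C(v)$ over configurations $C$ subject to $w(C)\le w(\mathbf{T})$ for every strategy $T$ rooted at $r$ with its weight function $w$. -}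

module Defs where

open import Data.Bool using (Bool; true; false; if_then_else_)
open import Data.Bool.Properties using () renaming (_≟_ to _≟B_)
open import Data.Nat as ℕ using (ℕ; zero; suc; _∸_; _≤_; _<_)
open import Data.Integer using (+_)
open import Data.Rational as ℚ using (ℚ; 0ℚ; _/_)
open import Data.Vec using (Vec; []; _∷_)
open import Data.Vec.Properties using (≡-dec)
open import Data.List using (List; []; _∷_; _++_; map)
open import Data.Product using (Σ; ∃; _×_; _,_)
open import Relation.Nullary using (¬_; yes; no; Dec)
open import Relation.Binary.PropositionalEquality using (_≡_)
open import Relation.Binary.Construct.Closure.ReflexiveTransitive using (Star)

-- The hypercube Q^d.  A vertex (a subset of {1,…,d}) is its
-- characteristic vector in Vec Bool d.

V : ℕ → Set
V d = Vec Bool d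

_≟V_ : ∀ {d} (u v : V d) → Dec (u ≡ v)
_≟V_ = ≡-dec _≟B_

hamming : ∀ {d} → V d → V d → ℕ
hamming [] [] = 0
hamming (a ∷ u) (b ∷ v) with a ≟B b
... | yes _ = hamming u v
... | no  _ = suc (hamming u v)

Adj : ∀ {d} → V d → V d → Set
Adj u v = hamming u v ≡ 1

allV : (d : ℕ) → List (V d)
allV zero    = [] ∷ []
allV (suc d) = map (true ∷_) (allV d) ++ map (false ∷_) (allV d)

sumℕ : ∀ {d} → (V d → ℕ) → List (V d) → ℕ
sumℕ f []       = 0
sumℕ f (v ∷ vs) = f v ℕ.+ sumℕ f vs

sumℚ : ∀ {d} → (V d → ℚ) → List (V d) → ℚ
sumℚ f []       = 0ℚ
sumℚ f (v ∷ vs) = f v ℚ.+ sumℚ f vs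

toℚ : ℕ → ℚ
toℚ n = + n / 1

Config : ℕ → Set
Config d = V d → ℕ

size : ∀ {d} → Config d → ℕ
size {d} C = sumℕ C (allV d)

-- the pebbling step from u to v applied to C (C u ≥ 2 assumed separately)
step : ∀ {d} → Config d → V d → V d → Config d
step C u v x with x ≟V u | x ≟V v
... | yes _ | _     = C x ∸ 2
... | no _  | yes _ = suc (C x)
... | no _  | no _  = C x

data PebStep {d : ℕ} (C : Config d) : Config d → Set where
  peb : (u v : V d) → Adj u v → 2 ≤ C u → PebStep C (step C u v)

Solvable : ∀ {d} → Config d → V d → Set
Solvable C r = ∃ λ C' → Star PebStep C C' × 1 ≤ C' r

AllSolvable : (d : ℕ) → V d → ℕ → Set
AllSolvable d r t = (C : Config d) → size C ≡ t → Solvable C r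

IsPebblingNumber : (d : ℕ) → V d → ℕ → Set
IsPebblingNumber d r t = AllSolvable d r t × ((s : ℕ) → AllSolvable d r s → t ≤ s)

iter : ∀ {A : Set} → (A → A) → ℕ → A → A
iter f zero    x = x
iter f (suc k) x = f (iter f k x)

-- A strategy rooted at r: a subtree T of Q^d containing r, with at
-- least two vertices, given by membership inT and parent map par
-- (v⁺ = par v); the tree edges are {v, par v} for v ∈ T, v ≠ r, and
-- every vertex of T reaches r by following parents; together with a
-- weight function w.
record Strategy (d : ℕ) (r : V d) : Set where
  field
    inT      : V d → Bool
    par      : V d → V d
    root∈T   : inT r ≡ true
    par∈T    : ∀ v → inT v ≡ true → ¬ v ≡ r → inT (par v) ≡ true
    parAdj   : ∀ v → inT v ≡ true → ¬ v ≡ r → Adj v (par v)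
    toRoot   : ∀ v → inT v ≡ true → ∃ λ k → iter par k v ≡ r
    twoVerts : ∃ λ v → inT v ≡ true × ¬ v ≡ r
    w        : V d → ℚ
    w≥0      : ∀ v → 0ℚ ℚ.≤ w v
    w≢0      : ∃ λ v → ¬ w v ≡ 0ℚ
    wr       : w r ≡ 0ℚ
    wOff     : ∀ v → inT v ≡ false → w v ≡ 0ℚ
    wDouble  : ∀ v → inT v ≡ true → ¬ v ≡ r → ¬ par v ≡ r →
               w (par v) ≡ toℚ 2 ℚ.* w v

wC : ∀ {d r} → Strategy d r → Config d → ℚ
wC {d} S C = sumℚ (λ v → Strategy.w S v ℚ.* toℚ (C v)) (allV d)

wT : ∀ {d r} → Strategy d r → ℚ
wT {d} S = sumℚ (λ v → if Strategy.inT S v then Strategy.w S v else 0ℚ) (allV d)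

Feasible : (d : ℕ) → V d → Config d → Set
Feasible d r C = (S : Strategy d r) → wC S C ℚ.≤ wT S

objective : ∀ {d} → V d → Config d → ℕ
objective {d} r C =
  sumℕ (λ v → if ⌊ v ≟V r ⌋ then 0 else C v) (allV d)
  where open import Relation.Nullary.Decidable using (⌊_⌋)

IsZ : (d : ℕ) → V d → ℕ → Set
IsZ d r z = (∃ λ C → Feasible d r C × objective r C ≡ z)
          × ((C : Config d) → Feasible d r C → objective r C ≤ z)

{-# OPTIONS --safe #-}
module Submission where

-- Identify a vertex with the set u of coordinates in which it agrees with r, so
-- that r is the full set.  For every set h there is a strategy whose tree
-- consists of the subsets of h and one chain from h up to the full set, with
-- weight 2^|u| at u.  A fixed u lies in 2^(d-|u|) of the sets h, so summing over
-- all h gives every non-root vertex weight at least 2^d, while the total weight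
-- is 2 (4^d - 3^d).  Hence a feasible configuration has objective below 2^(d+1).
-- On the other hand fewer than 2^d pebbles at the antipode of r do not solve r,
-- because no step increases the sum of 2^|u| over all pebbles.

open import Defs
open import Data.Nat using (ℕ; _≤_; _<_; _*_)

open import Data.Bool using (Bool; true; false; not; if_then_else_)
import Data.Integer as ℤ
import Data.Integer.Properties as ℤ
open import Data.List using ([]; _∷_; _++_; map)
open import Data.Nat using (zero; suc; _+_; _∸_; _^_; z≤n; s≤s)
open import Data.Nat.Properties
open import Data.Nat.Solver using (module +-*-Solver)
open import Data.Product using (_,_)
open import Data.Rational as ℚ using (ℚ; 0ℚ)
import Data.Rational.Properties as ℚ
open import Data.Rational.Unnormalised as ℚᵘ using (mkℚᵘ; *≡*)
import Data.Rational.Unnormalised.Properties as ℚᵘ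
open import Data.Vec using ([]; _∷_; replicate)
open import Function using (_∘_)
open import Relation.Binary.Construct.Closure.ReflexiveTransitive using (Star; ε; _◅_)
open import Relation.Binary.PropositionalEquality
open import Relation.Nullary using (¬_; does; yes; no; contradiction)
open import Relation.Nullary.Decidable using (⌊_⌋; dec-true; dec-false)

open +-*-Solver using (solve; _:+_; _:*_; _:=_; con)

private
  variable
    d : ℕ

-- Sums over the vertices

module _ {d : ℕ} where

  sumℕ-cong : ∀ {f g : V d → ℕ} → (∀ v → f v ≡ g v) → ∀ l → sumℕ f l ≡ sumℕ g l
  sumℕ-cong f≗g []      = refl
  sumℕ-cong f≗g (v ∷ l) = cong₂ _+_ (f≗g v) (sumℕ-cong f≗g l)

  sumℕ-mono : ∀ {f g : V d → ℕ} → (∀ v → f v ≤ g v) → ∀ l → sumℕ f l ≤ sumℕ g l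
  sumℕ-mono f≤g []      = z≤n
  sumℕ-mono f≤g (v ∷ l) = +-mono-≤ (f≤g v) (sumℕ-mono f≤g l)

  sumℕ-+ : ∀ (f g : V d → ℕ) l → sumℕ (λ v → f v + g v) l ≡ sumℕ f l + sumℕ g l
  sumℕ-+ f g []      = refl
  sumℕ-+ f g (v ∷ l) rewrite sumℕ-+ f g l =
    solve 4 (λ a b s t → (a :+ b) :+ (s :+ t) := (a :+ s) :+ (b :+ t)) refl
      (f v) (g v) (sumℕ f l) (sumℕ g l)

  sumℕ-*ˡ : ∀ k (f : V d → ℕ) l → sumℕ (λ v → k * f v) l ≡ k * sumℕ f l
  sumℕ-*ˡ k f []      = sym (*-zeroʳ k)
  sumℕ-*ˡ k f (v ∷ l) rewrite sumℕ-*ˡ k f l = sym (*-distribˡ-+ k (f v) (sumℕ f l))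

  sumℕ-0 : ∀ l → sumℕ {d} (λ _ → 0) l ≡ 0
  sumℕ-0 []      = refl
  sumℕ-0 (_ ∷ l) = sumℕ-0 l

  sumℕ-++ : ∀ (f : V d → ℕ) l m → sumℕ f (l ++ m) ≡ sumℕ f l + sumℕ f m
  sumℕ-++ f []      m = refl
  sumℕ-++ f (v ∷ l) m rewrite sumℕ-++ f l m = sym (+-assoc (f v) (sumℕ f l) (sumℕ f m))

sumℕ-map : ∀ (f : V (suc d) → ℕ) (g : V d → V (suc d)) l → sumℕ f (map g l) ≡ sumℕ (f ∘ g) l
sumℕ-map f g []      = refl
sumℕ-map f g (v ∷ l) = cong (f (g v) +_) (sumℕ-map f g l)

sumℕ-swap : ∀ (f : V d → V d → ℕ) k l →
            sumℕ (λ u → sumℕ (f u) l) k ≡ sumℕ (λ v → sumℕ (λ u → f u v) k) l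
sumℕ-swap f []      l = sym (sumℕ-0 l)
sumℕ-swap f (u ∷ k) l = trans (cong (sumℕ (f u) l +_) (sumℕ-swap f k l))
                              (sym (sumℕ-+ (f u) (λ v → sumℕ (λ u → f u v) k) l))

∑ : (V d → ℕ) → ℕ
∑ {d} f = sumℕ f (allV d)

∑-suc : ∀ (f : V (suc d) → ℕ) → ∑ f ≡ ∑ (f ∘ (true ∷_)) + ∑ (f ∘ (false ∷_))
∑-suc {d} f = trans (sumℕ-++ f (map (true ∷_) (allV d)) _)
                    (cong₂ _+_ (sumℕ-map f _ (allV d)) (sumℕ-map f _ (allV d)))

∑-const : ∀ d k → ∑ {d} (λ _ → k) ≡ 2 ^ d * k
∑-const zero    k = refl
∑-const (suc d) k rewrite ∑-suc {d} (λ _ → k) | ∑-const d k =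
  solve 2 (λ p k → p :* k :+ p :* k := con 2 :* p :* k) refl (2 ^ d) k

-- With does instead of ⌊_⌋ the test computes on the heads of x and u.
δ : V d → V d → ℕ
δ u x = if does (x ≟V u) then 1 else 0

-- Only the half of the cube with head `b` contributes: on the other half `δ` computes to 0.
∑-δ : ∀ (u : V d) (f : V d → ℕ) → ∑ (λ x → δ u x * f x) ≡ f u
∑-δ []          f = trans (+-identityʳ _) (+-identityʳ _)
∑-δ {suc d} (b ∷ u) f rewrite ∑-suc (λ x → δ (b ∷ u) x * f x) = go b
  where
  go : ∀ b → ∑ (λ x → δ (b ∷ u) (true ∷ x) * f (true ∷ x)) +
             ∑ (λ x → δ (b ∷ u) (false ∷ x) * f (false ∷ x)) ≡ f (b ∷ u)
  go true  = trans (cong₂ _+_ (∑-δ u (f ∘ (true ∷_))) (sumℕ-0 (allV d))) (+-identityʳ _)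
  go false = cong₂ _+_ (sumℕ-0 (allV d)) (∑-δ u (f ∘ (false ∷_)))

term≤∑ : ∀ (f : V d → ℕ) u → f u ≤ ∑ f
term≤∑ {d} f u = subst (_≤ ∑ f) (∑-δ u f) (sumℕ-mono (λ x → δ*≤ x) (allV d))
  where
  δ*≤ : ∀ x → δ u x * f x ≤ f x
  δ*≤ x with does (x ≟V u)
  ... | true  = ≤-reflexive (+-identityʳ (f x))
  ... | false = z≤n

-- Coordinates relative to the root

does-true⁻¹ : ∀ {u v : V d} → does (u ≟V v) ≡ true → u ≡ v
does-true⁻¹ {u = u} {v} eq with u ≟V v
... | yes u≡v = u≡v

top : V d
top {d} = replicate d true

card : V d → ℕ
card []          = 0
card (true  ∷ u) = suc (card u)
card (false ∷ u) = card u

-- For fixed `r` this is an involutive automorphism of the cube that exchanges `r` and `top`, so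
-- trees need only be built for the root `top`.
agree : V d → V d → V d
agree []          []      = []
agree (true  ∷ r) (b ∷ v) = b ∷ agree r v
agree (false ∷ r) (b ∷ v) = not b ∷ agree r v

agree-involutive : ∀ (r v : V d) → agree r (agree r v) ≡ v
agree-involutive []          []          = refl
agree-involutive (true  ∷ r) (b ∷ v)     = cong (b ∷_) (agree-involutive r v)
agree-involutive (false ∷ r) (true  ∷ v) = cong (true ∷_) (agree-involutive r v)
agree-involutive (false ∷ r) (false ∷ v) = cong (false ∷_) (agree-involutive r v)

agree-self : ∀ (r : V d) → agree r r ≡ top
agree-self []          = refl
agree-self (true  ∷ r) = cong (true ∷_) (agree-self r)
agree-self (false ∷ r) = cong (true ∷_) (agree-self r)

agree-top : ∀ (r : V d) → agree r top ≡ r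
agree-top r = trans (cong (agree r) (sym (agree-self r))) (agree-involutive r r)

agree≡top⇒≡ : ∀ {r v : V d} → agree r v ≡ top → v ≡ r
agree≡top⇒≡ {r = r} {v} eq =
  trans (sym (agree-involutive r v)) (trans (cong (agree r) eq) (agree-top r))

hamming-agree : ∀ (r u v : V d) → hamming (agree r u) (agree r v) ≡ hamming u v
hamming-agree []          []          []          = refl
hamming-agree (true  ∷ r) (true  ∷ u) (true  ∷ v) = hamming-agree r u v
hamming-agree (true  ∷ r) (true  ∷ u) (false ∷ v) = cong suc (hamming-agree r u v)
hamming-agree (true  ∷ r) (false ∷ u) (true  ∷ v) = cong suc (hamming-agree r u v)
hamming-agree (true  ∷ r) (false ∷ u) (false ∷ v) = hamming-agree r u v
hamming-agree (false ∷ r) (true  ∷ u) (true  ∷ v) = hamming-agree r u v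
hamming-agree (false ∷ r) (true  ∷ u) (false ∷ v) = cong suc (hamming-agree r u v)
hamming-agree (false ∷ r) (false ∷ u) (true  ∷ v) = cong suc (hamming-agree r u v)
hamming-agree (false ∷ r) (false ∷ u) (false ∷ v) = hamming-agree r u v

-- `agree r` permutes the vertices: a `false` at the head of `r` swaps the two halves of the cube.
∑-agree : ∀ (r : V d) (f : V d → ℕ) → ∑ (f ∘ agree r) ≡ ∑ f
∑-agree []          f = refl
∑-agree (true  ∷ r) f
  rewrite ∑-suc (f ∘ agree (true ∷ r)) | ∑-suc f
        | ∑-agree r (f ∘ (true ∷_)) | ∑-agree r (f ∘ (false ∷_)) = refl
∑-agree (false ∷ r) f
  rewrite ∑-suc (f ∘ agree (false ∷ r)) | ∑-suc f
        | ∑-agree r (f ∘ (true ∷_)) | ∑-agree r (f ∘ (false ∷_)) = +-comm (∑ (f ∘ (false ∷_))) _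

hamming-refl : ∀ (u : V d) → hamming u u ≡ 0
hamming-refl []          = refl
hamming-refl (true  ∷ u) = hamming-refl u
hamming-refl (false ∷ u) = hamming-refl u

-- Every element of `v` outside `u` counts in the distance. Hence moving to a neighbour raises
-- `card` by at most one.
card-≤-hamming : ∀ (u v : V d) → card v ≤ hamming u v + card u
card-≤-hamming []          []          = z≤n
card-≤-hamming (true  ∷ u) (true  ∷ v) =
  subst (suc (card v) ≤_) (sym (+-suc (hamming u v) (card u))) (s≤s (card-≤-hamming u v))
card-≤-hamming (true  ∷ u) (false ∷ v) =
  m≤n⇒m≤1+n (subst (card v ≤_) (sym (+-suc (hamming u v) (card u))) (m≤n⇒m≤1+n (card-≤-hamming u v)))
card-≤-hamming (false ∷ u) (true  ∷ v) = s≤s (card-≤-hamming u v)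
card-≤-hamming (false ∷ u) (false ∷ v) = card-≤-hamming u v

card-top : ∀ d → card (top {d}) ≡ d
card-top zero    = refl
card-top (suc d) = cong suc (card-top d)

-- The trees

_⊆ᵇ_ : V d → V d → Bool
[]          ⊆ᵇ []          = true
(false ∷ u) ⊆ᵇ (_     ∷ h) = u ⊆ᵇ h
(true  ∷ u) ⊆ᵇ (true  ∷ h) = u ⊆ᵇ h
(true  ∷ u) ⊆ᵇ (false ∷ h) = false

-- The subsets of h together with the chain from h to top which adds the
-- coordinates missing from h one at a time, the last coordinate first.
tree : V d → V d → Bool
tree []          []          = true
tree (true  ∷ h) (true  ∷ u) = tree h u
tree (true  ∷ h) (false ∷ u) = u ⊆ᵇ h
tree (false ∷ h) (true  ∷ u) = does (u ≟V top)
tree (false ∷ h) (false ∷ u) = tree h u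

-- Adds the first element of `h` missing from `u`; once `u` contains `h`, adds the last missing
-- coordinate. Subsets of `h` thus climb to `h` and then follow the chain.
parent : V d → V d → V d
parent []          []          = []
parent (_     ∷ h) (true  ∷ u) = true ∷ parent h u
parent (true  ∷ h) (false ∷ u) = true ∷ u
parent (false ∷ h) (false ∷ u) = if does (u ≟V top) then true ∷ u else false ∷ parent h u

tree-top : ∀ (h : V d) → tree h top ≡ true
tree-top []          = refl
tree-top (true  ∷ h) = tree-top h
tree-top {suc d} (false ∷ h) = dec-true (top {d} ≟V top) refl

⊆⇒tree : ∀ (h u : V d) → u ⊆ᵇ h ≡ true → tree h u ≡ true
⊆⇒tree []          []          _ = refl
⊆⇒tree (true  ∷ h) (true  ∷ u) p = ⊆⇒tree h u p
⊆⇒tree (true  ∷ h) (false ∷ u) p = p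
⊆⇒tree (false ∷ h) (false ∷ u) p = ⊆⇒tree h u p

tree-parent : ∀ (h u : V d) → ¬ u ≡ top → tree h u ≡ true → tree h (parent h u) ≡ true
tree-parent []          []          _ _ = refl
tree-parent (true  ∷ h) (true  ∷ u) u≢ p = tree-parent h u (u≢ ∘ cong (true ∷_)) p
-- The added element lies in `h`, so a subset of `h` stays one.
tree-parent (true  ∷ h) (false ∷ u) _ p = ⊆⇒tree h u p
-- A first coordinate missing from `h` is the last to be added on the chain, so only `top` contains
-- it.
tree-parent (false ∷ h) (true  ∷ u) u≢ p = contradiction (cong (true ∷_) (does-true⁻¹ p)) u≢
tree-parent (false ∷ h) (false ∷ u) _ p with u ≟V top
... | yes u≡ = dec-true (u ≟V top) u≡
... | no u≢ = tree-parent h u u≢ p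

parent-adj : ∀ (h u : V d) → ¬ u ≡ top → Adj u (parent h u)
parent-adj []          []          u≢ = contradiction refl u≢
parent-adj (_     ∷ h) (true  ∷ u) u≢ = parent-adj h u (u≢ ∘ cong (true ∷_))
parent-adj (true  ∷ h) (false ∷ u) _ = cong suc (hamming-refl u)
parent-adj (false ∷ h) (false ∷ u) _ with u ≟V top
... | yes _ = cong suc (hamming-refl u)
... | no u≢ = parent-adj h u u≢

-- This makes `2 ^ card u` double along tree edges and makes every path of parents end at `top`.
card-parent : ∀ (h u : V d) → ¬ u ≡ top → card (parent h u) ≡ suc (card u)
card-parent []          []          u≢ = contradiction refl u≢
card-parent (_     ∷ h) (true  ∷ u) u≢ = cong suc (card-parent h u (u≢ ∘ cong (true ∷_)))
card-parent (true  ∷ h) (false ∷ u) _ = refl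
card-parent (false ∷ h) (false ∷ u) _ with u ≟V top
... | yes _ = refl
... | no u≢ = card-parent h u u≢

card≤d : ∀ (u : V d) → card u ≤ d
card≤d []          = z≤n
card≤d (true  ∷ u) = s≤s (card≤d u)
card≤d (false ∷ u) = m≤n⇒m≤1+n (card≤d u)

card≡d⇒top : ∀ (u : V d) → card u ≡ d → u ≡ top
card≡d⇒top []          _  = refl
card≡d⇒top (true  ∷ u) eq = cong (true ∷_) (card≡d⇒top u (suc-injective eq))
card≡d⇒top (false ∷ u) eq = contradiction (card≤d u) (<⇒≱ (≤-reflexive (sym eq)))

iter-shift : ∀ {A : Set} (f : A → A) k x → iter f k (f x) ≡ iter f (suc k) x
iter-shift f zero    x = refl
iter-shift f (suc k) x = cong f (iter-shift f k x)

-- `k` counts the coordinates missing from `u`; each parent supplies one of them.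
iter-parent : ∀ (h u : V d) k → k + card u ≡ d → iter (parent h) k u ≡ top
iter-parent h u zero    eq = card≡d⇒top u eq
iter-parent {d} h u (suc k) eq =
  trans (sym (iter-shift (parent h) k u))
        (iter-parent h (parent h u) k
          (trans (cong (k +_) (card-parent h u u≢)) (trans (+-suc k (card u)) eq)))
  where
  u≢ : ¬ u ≡ top
  u≢ refl = m≢1+n+m d (sym (trans (cong (suc k +_) (sym (card-top d))) eq))


-- Weights

-- `full` keeps the value `2 ^ d` at the root, so that its sum obeys a recursion on the dimension;
-- `weight` erases it, as a strategy must. `sub` is the part on the subsets of `h`.
sub full weight : V d → V d → ℕ
sub h u    = if u ⊆ᵇ h then 2 ^ card u else 0
full h u   = if tree h u then 2 ^ card u else 0
weight h u = if does (u ≟V top) then 0 else full h u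

if-*ˡ : ∀ k b n → (if b then k * n else 0) ≡ k * (if b then n else 0)
if-*ˡ k true  n = refl
if-*ˡ k false n = sym (*-zeroʳ k)

-- Each coordinate gives a factor 2: an element of `u` is forced into `h` but doubles the weight,
-- and any other coordinate leaves two choices for `h`.
∑-sub : ∀ (u : V d) → ∑ (λ h → sub h u) ≡ 2 ^ d
∑-sub []          = refl
∑-sub {suc d} (true  ∷ u)
  rewrite ∑-suc (λ h → sub h (true ∷ u))
        | sumℕ-0 (allV d)
        | sumℕ-cong (λ h → if-*ˡ 2 (u ⊆ᵇ h) (2 ^ card u)) (allV d)
        | sumℕ-*ˡ 2 (λ h → sub h u) (allV d)
        | ∑-sub u = +-identityʳ _
∑-sub {suc d} (false ∷ u)
  rewrite ∑-suc (λ h → sub h (false ∷ u))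
        | ∑-sub u = cong (2 ^ d +_) (sym (+-identityʳ (2 ^ d)))

sub≤full : ∀ (h u : V d) → sub h u ≤ full h u
sub≤full h u with u ⊆ᵇ h in eq
... | false = z≤n
... | true rewrite ⊆⇒tree h u eq = ≤-refl

-- The half with head `true` is the tree of `h` with doubled weights; the other half consists of the
-- subsets of `h`.
∑-full-true : ∀ (h : V d) → ∑ (full (true ∷ h)) ≡ 2 * ∑ (full h) + ∑ (sub h)
∑-full-true {d} h
  rewrite ∑-suc (full (true ∷ h))
        | sumℕ-cong (λ u → if-*ˡ 2 (tree h u) (2 ^ card u)) (allV d)
        | sumℕ-*ˡ 2 (full h) (allV d) = refl

full-false-true : ∀ (h u : V d) → full (false ∷ h) (true ∷ u) ≡ δ top u * 2 ^ suc (card u)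
full-false-true h u with does (u ≟V top)
... | true  = sym (+-identityʳ _)
... | false = refl

-- The half with head `true` meets the tree only in `top`; the other half is the tree of `h`.
∑-full-false : ∀ (h : V d) → ∑ (full (false ∷ h)) ≡ 2 ^ suc d + ∑ (full h)
∑-full-false {d} h
  rewrite ∑-suc (full (false ∷ h))
        | sumℕ-cong (full-false-true h) (allV d)
        | ∑-δ (top {d}) (λ u → 2 ^ suc (card u))
        | card-top d = refl

∑∑-sub : ∀ d → ∑ {d} (λ h → ∑ (sub h)) ≡ 2 ^ d * 2 ^ d
∑∑-sub d = trans (sumℕ-swap sub (allV d) (allV d))
                 (trans (sumℕ-cong ∑-sub (allV d)) (∑-const d (2 ^ d)))

-- By the two recursions above, the double sum `Y` becomes `3 * Y + 3 * 4 ^ d` in the next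
-- dimension. The solution `3 * 4 ^ d - 2 * 3 ^ d` is stated without subtraction.
∑∑-full : ∀ d → ∑ {d} (λ h → ∑ (full h)) + 2 * 3 ^ d ≡ 3 * (2 ^ d * 2 ^ d)
∑∑-full zero    = refl
∑∑-full (suc d)
  rewrite ∑-suc {d} (λ h → ∑ (full h))
        | sumℕ-cong (∑-full-true {d}) (allV d)
        | sumℕ-cong (∑-full-false {d}) (allV d)
        | sumℕ-+ (λ h → 2 * ∑ (full h)) (λ h → ∑ (sub h)) (allV d)
        | sumℕ-*ˡ 2 (λ h → ∑ (full h)) (allV d)
        | ∑∑-sub d
        | sumℕ-+ (λ _ → 2 ^ suc d) (λ h → ∑ (full h)) (allV d)
        | ∑-const d (2 ^ suc d) = begin
    2 * Y + p * p + (p * (2 * p) + Y) + 2 * (3 * q)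
      ≡⟨ solve 3 (λ Y p q → con 2 :* Y :+ p :* p :+ (p :* (con 2 :* p) :+ Y) :+ con 2 :* (con 3 :* q)
                   := con 3 :* (Y :+ con 2 :* q) :+ con 3 :* (p :* p)) refl Y p q ⟩
    3 * (Y + 2 * q) + 3 * (p * p)
      ≡⟨ cong (λ x → 3 * x + 3 * (p * p)) (∑∑-full d) ⟩
    3 * (3 * (p * p)) + 3 * (p * p)
      ≡⟨ solve 1 (λ p → con 3 :* (con 3 :* (p :* p)) :+ con 3 :* (p :* p)
                   := con 3 :* (con 2 :* p :* (con 2 :* p))) refl p ⟩
    3 * (2 * p * (2 * p)) ∎
  where
  open ≡-Reasoning
  Y = ∑ {d} (λ h → ∑ (full h))
  p = 2 ^ d
  q = 3 ^ d

∑-weight : ∀ (h : V d) → ∑ (weight h) + 2 ^ d ≡ ∑ (full h)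
∑-weight {d} h = begin
  ∑ (weight h) + 2 ^ d                          ≡⟨ cong (∑ (weight h) +_) (sym full-top) ⟩
  ∑ (weight h) + full h top                     ≡⟨ cong (∑ (weight h) +_) (sym (∑-δ top (full h))) ⟩
  ∑ (weight h) + ∑ (λ u → δ top u * full h u)   ≡⟨ sym (sumℕ-+ (weight h) _ (allV d)) ⟩
  ∑ (λ u → weight h u + δ top u * full h u)     ≡⟨ sumℕ-cong split (allV d) ⟩
  ∑ (full h)                                    ∎
  where
  open ≡-Reasoning
  full-top : full h top ≡ 2 ^ d
  full-top rewrite tree-top h | card-top d = refl
  split : ∀ u → weight h u + δ top u * full h u ≡ full h u
  split u with does (u ≟V top)
  ... | true  = +-identityʳ _
  ... | false = +-identityʳ _

∑∑-weight : ∀ d → ∑ {d} (λ h → ∑ (weight h)) < 2 ^ d * (2 * 2 ^ d)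
∑∑-weight d = +-cancelʳ-< (p * p) _ _ (begin-strict
  ∑ {d} (λ h → ∑ (weight h)) + p * p
    ≡⟨ cong (∑ {d} (λ h → ∑ (weight h)) +_) (sym (∑-const d p)) ⟩
  ∑ {d} (λ h → ∑ (weight h)) + ∑ {d} (λ _ → p)
    ≡⟨ sym (sumℕ-+ {d} (λ h → ∑ (weight h)) (λ _ → p) (allV d)) ⟩
  ∑ {d} (λ h → ∑ (weight h) + p)
    ≡⟨ sumℕ-cong ∑-weight (allV d) ⟩
  ∑ {d} (λ h → ∑ (full h))
    -- The strict inequality comes from discarding the positive term `2 * 3 ^ d`.
    <⟨ m<m+n _ (*-monoʳ-< 2 (m^n>0 3 d)) ⟩
  ∑ {d} (λ h → ∑ (full h)) + 2 * 3 ^ d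
    ≡⟨ ∑∑-full d ⟩
  3 * (p * p)
    ≡⟨ solve 1 (λ p → con 3 :* (p :* p) := p :* (con 2 :* p) :+ p :* p) refl p ⟩
  p * (2 * p) + p * p ∎)
  where
  open ≤-Reasoning
  p = 2 ^ d

-- Natural numbers inside ℚ

-- `toℚ n` is normalised by a gcd that is stuck on a variable `n`; identities are therefore checked
-- on unnormalised fractions, where the stored 0 encodes the denominator 1.
toℚᵘ-toℚ : ∀ n → ℚ.toℚᵘ (toℚ n) ℚᵘ.≃ mkℚᵘ (ℤ.+ n) 0
toℚᵘ-toℚ n = ℚ.toℚᵘ-fromℚᵘ (mkℚᵘ (ℤ.+ n) 0)

toℚ-+ : ∀ m n → toℚ (m + n) ≡ toℚ m ℚ.+ toℚ n
toℚ-+ m n = ℚ.toℚᵘ-injective (begin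
  ℚ.toℚᵘ (toℚ (m + n))                 ≈⟨ toℚᵘ-toℚ (m + n) ⟩
  mkℚᵘ (ℤ.+ (m + n)) 0                 ≈⟨ *≡* (cong (ℤ._* ℤ.+ 1)
    (sym (cong₂ ℤ._+_ (ℤ.*-identityʳ (ℤ.+ m)) (ℤ.*-identityʳ (ℤ.+ n))))) ⟩
  mkℚᵘ (ℤ.+ m) 0 ℚᵘ.+ mkℚᵘ (ℤ.+ n) 0   ≈⟨ ℚᵘ.+-cong (toℚᵘ-toℚ m) (toℚᵘ-toℚ n) ⟨
  ℚ.toℚᵘ (toℚ m) ℚᵘ.+ ℚ.toℚᵘ (toℚ n)   ≈⟨ ℚ.toℚᵘ-homo-+ (toℚ m) (toℚ n) ⟨
  ℚ.toℚᵘ (toℚ m ℚ.+ toℚ n)             ∎)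
  where open ℚᵘ.≃-Reasoning

toℚ-* : ∀ m n → toℚ (m * n) ≡ toℚ m ℚ.* toℚ n
toℚ-* m n = ℚ.toℚᵘ-injective (begin
  ℚ.toℚᵘ (toℚ (m * n))                 ≈⟨ toℚᵘ-toℚ (m * n) ⟩
  mkℚᵘ (ℤ.+ (m * n)) 0                 ≈⟨ *≡* (cong (ℤ._* ℤ.+ 1) (ℤ.pos-* m n)) ⟩
  mkℚᵘ (ℤ.+ m) 0 ℚᵘ.* mkℚᵘ (ℤ.+ n) 0   ≈⟨ ℚᵘ.*-cong (toℚᵘ-toℚ m) (toℚᵘ-toℚ n) ⟨
  ℚ.toℚᵘ (toℚ m) ℚᵘ.* ℚ.toℚᵘ (toℚ n)   ≈⟨ ℚ.toℚᵘ-homo-* (toℚ m) (toℚ n) ⟨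
  ℚ.toℚᵘ (toℚ m ℚ.* toℚ n)             ∎)
  where open ℚᵘ.≃-Reasoning

toℚ-cancel-≤ : ∀ {m n} → toℚ m ℚ.≤ toℚ n → m ≤ n
toℚ-cancel-≤ {m} {n} p = ℤ.drop‿+≤+ (subst₂ ℤ._≤_ (ℤ.*-identityʳ (ℤ.+ m)) (ℤ.*-identityʳ (ℤ.+ n)) (ℚᵘ.drop-*≤* (begin
  mkℚᵘ (ℤ.+ m) 0   ≃⟨ toℚᵘ-toℚ m ⟨
  ℚ.toℚᵘ (toℚ m)   ≤⟨ ℚ.toℚᵘ-mono-≤ p ⟩
  ℚ.toℚᵘ (toℚ n)   ≃⟨ toℚᵘ-toℚ n ⟩
  mkℚᵘ (ℤ.+ n) 0   ∎)))
  where open ℚᵘ.≤-Reasoning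

0≤toℚ : ∀ n → 0ℚ ℚ.≤ toℚ n
0≤toℚ n = ℚ.nonNegative⁻¹ (toℚ n) ⦃ ℚ.normalize-nonNeg n 1 ⦄

sumℚ-toℚ : ∀ {f : V d → ℚ} (g : V d → ℕ) → (∀ v → f v ≡ toℚ (g v)) → ∀ l → sumℚ f l ≡ toℚ (sumℕ g l)
sumℚ-toℚ g eq []      = refl
sumℚ-toℚ g eq (v ∷ l) = trans (cong₂ ℚ._+_ (eq v) (sumℚ-toℚ g eq l)) (sym (toℚ-+ (g v) (sumℕ g l)))

toℚ≡0⇒≡0 : ∀ {n} → toℚ n ≡ 0ℚ → n ≡ 0
toℚ≡0⇒≡0 eq = n≤0⇒n≡0 (toℚ-cancel-≤ (ℚ.≤-reflexive eq))

-- The strategies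

weight-root : ∀ (h : V d) → weight h top ≡ 0
weight-root {d} h rewrite dec-true (top {d} ≟V top) refl = refl

weight-off : ∀ (h u : V d) → tree h u ≡ false → weight h u ≡ 0
weight-off h u eq with does (u ≟V top)
... | true  = refl
... | false rewrite eq = refl

weight-on : ∀ (h u : V d) → ¬ u ≡ top → tree h u ≡ true → weight h u ≡ 2 ^ card u
weight-on h u u≢ eq rewrite dec-false (u ≟V top) u≢ | eq = refl

weight-double : ∀ (h u : V d) → tree h u ≡ true → ¬ u ≡ top → ¬ parent h u ≡ top →
                weight h (parent h u) ≡ 2 * weight h u
weight-double h u u∈ u≢ p≢
  rewrite weight-on h (parent h u) p≢ (tree-parent h u u≢ u∈) | weight-on h u u≢ u∈
        | card-parent h u u≢ = refl

bottom : V d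
bottom {d} = replicate d false

bottom-⊆ : ∀ (h : V d) → bottom ⊆ᵇ h ≡ true
bottom-⊆ []      = refl
bottom-⊆ (_ ∷ h) = bottom-⊆ h

card-bottom : ∀ d → card (bottom {d}) ≡ 0
card-bottom zero    = refl
card-bottom (suc d) = card-bottom d

-- In dimension 0 the two coincide; positive dimension supplies the second vertex of a strategy.
bottom≢top : ¬ bottom {suc d} ≡ top
bottom≢top ()

strategy : (r h : V (suc d)) → Strategy (suc d) r
strategy {d} r h = record
  { inT      = tree h ∘ agree r
  ; par      = par
  ; root∈T   = trans (cong (tree h) (agree-self r)) (tree-top h)
  ; par∈T    = λ v v∈ v≢r → trans (cong (tree h) (agree-par v))
                                  (tree-parent h (agree r v) (v≢r ∘ agree≡top⇒≡) v∈)
  ; parAdj   = λ v v∈ v≢r → trans (sym (hamming-agree r v (par v)))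
                 (trans (cong (hamming (agree r v)) (agree-par v))
                        (parent-adj h (agree r v) (v≢r ∘ agree≡top⇒≡)))
  -- The number of steps is the number of coordinates in which `v` differs from `r`.
  ; toRoot   = λ v _ → suc d ∸ card (agree r v) , toRoot v
  -- The antipode of `r` corresponds to the empty set, which lies in every tree with weight 1; it
  -- also witnesses `w≢0`.
  ; twoVerts = agree r bottom , bottom∈ , bottom≢r
  ; w        = λ v → toℚ (weight h (agree r v))
  ; w≥0      = λ v → 0≤toℚ (weight h (agree r v))
  ; w≢0      = agree r bottom , λ eq → 0≢1+n (trans (sym (toℚ≡0⇒≡0 eq)) weight-bottom)
  ; wr       = cong toℚ (trans (cong (weight h) (agree-self r)) (weight-root h))
  ; wOff     = λ v v∉ → cong toℚ (weight-off h (agree r v) v∉)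
  ; wDouble  = λ v v∈ v≢r p≢r → trans
                 (cong toℚ (trans (cong (weight h) (agree-par v))
                   (weight-double h (agree r v) v∈ (v≢r ∘ agree≡top⇒≡)
                     (p≢r ∘ λ eq → trans (cong (agree r) eq) (agree-top r)))))
                 (toℚ-* 2 (weight h (agree r v)))
  }
  where
  par : V (suc d) → V (suc d)
  par v = agree r (parent h (agree r v))

  agree-par : ∀ v → agree r (par v) ≡ parent h (agree r v)
  agree-par v = agree-involutive r (parent h (agree r v))

  agree-iter : ∀ k v → agree r (iter par k v) ≡ iter (parent h) k (agree r v)
  agree-iter zero    v = refl
  agree-iter (suc k) v = trans (agree-par (iter par k v)) (cong (parent h) (agree-iter k v))

  toRoot : ∀ v → iter par (suc d ∸ card (agree r v)) v ≡ r
  toRoot v = agree≡top⇒≡ (trans (agree-iter (suc d ∸ card (agree r v)) v)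
    (iter-parent h (agree r v) _ (m∸n+n≡m (card≤d (agree r v)))))

  agree-bottom : agree r (agree r bottom) ≡ bottom
  agree-bottom = agree-involutive r bottom

  bottom∈ : tree h (agree r (agree r bottom)) ≡ true
  bottom∈ = trans (cong (tree h) agree-bottom) (⊆⇒tree h bottom (bottom-⊆ h))

  bottom≢r : ¬ agree r bottom ≡ r
  bottom≢r eq = bottom≢top (trans (sym agree-bottom) (trans (cong (agree r) eq) (agree-self r)))

  weight-bottom : weight h (agree r (agree r bottom)) ≡ 1
  weight-bottom = begin
    weight h (agree r (agree r bottom))  ≡⟨ cong (weight h) agree-bottom ⟩
    weight h bottom                      ≡⟨ weight-on h bottom bottom≢top (⊆⇒tree h bottom (bottom-⊆ h)) ⟩
    2 ^ card (bottom {suc d})            ≡⟨ cong (2 ^_) (card-bottom (suc d)) ⟩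
    1                                    ∎
    where open ≡-Reasoning

-- Summing the strategy inequalities over all sets

if-toℚ : ∀ b {n} → (b ≡ false → n ≡ 0) → (if b then toℚ n else 0ℚ) ≡ toℚ n
if-toℚ true  _   = refl
if-toℚ false n≡0 = cong toℚ (sym (n≡0 refl))

feasible⇒weight≤ : ∀ (r : V (suc d)) C → Feasible (suc d) r C → ∀ h →
                   ∑ (λ v → weight h (agree r v) * C v) ≤ ∑ (weight h)
feasible⇒weight≤ {d} r C feas h = subst (∑ (λ v → weight h (agree r v) * C v) ≤_) (∑-agree r (weight h))
  (toℚ-cancel-≤ (subst₂ ℚ._≤_
    (sumℚ-toℚ (λ v → weight h (agree r v) * C v) (λ v → sym (toℚ-* (weight h (agree r v)) (C v))) (allV (suc d)))
    (sumℚ-toℚ (weight h ∘ agree r) (λ v → if-toℚ _ (weight-off h (agree r v))) (allV (suc d)))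
    (feas (strategy r h))))

-- The sets `h` containing `u` already contribute `2 ^ d`, by `∑-sub`.
∑-weight-≥ : ∀ (u : V d) → ¬ u ≡ top → 2 ^ d ≤ ∑ (λ h → weight h u)
∑-weight-≥ {d} u u≢ rewrite dec-false (u ≟V top) u≢ =
  subst (_≤ ∑ (λ h → full h u)) (∑-sub u) (sumℕ-mono (λ h → sub≤full h u) (allV d))

feasible⇒objective< : ∀ (r : V (suc d)) C → Feasible (suc d) r C → objective r C < 2 * 2 ^ suc d
-- The cancelled factor `2 ^ suc d` is both the least total weight of a non-root vertex and the
-- number of sets `h`.
feasible⇒objective< {d} r C feas = *-cancelˡ-< (2 ^ suc d) _ _ (begin-strict
  2 ^ suc d * objective r C
    ≡⟨ sym (sumℕ-*ˡ (2 ^ suc d) _ vs) ⟩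
  ∑ (λ v → 2 ^ suc d * (if ⌊ v ≟V r ⌋ then 0 else C v))
    ≤⟨ sumℕ-mono covered vs ⟩
  ∑ (λ v → ∑ (λ h → weight h (agree r v)) * C v)
    ≡⟨ sumℕ-cong (λ v → trans (*-comm _ (C v)) (trans (sym (sumℕ-*ˡ (C v) _ vs))
         (sumℕ-cong (λ h → *-comm (C v) (weight h (agree r v))) vs))) vs ⟩
  ∑ (λ v → ∑ (λ h → weight h (agree r v) * C v))
    ≡⟨ sumℕ-swap (λ v h → weight h (agree r v) * C v) vs vs ⟩
  ∑ (λ h → ∑ (λ v → weight h (agree r v) * C v))
    ≤⟨ sumℕ-mono (feasible⇒weight≤ r C feas) vs ⟩
  ∑ {suc d} (λ h → ∑ (weight h))
    <⟨ ∑∑-weight (suc d) ⟩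
  2 ^ suc d * (2 * 2 ^ suc d) ∎)
  where
  open ≤-Reasoning
  vs = allV (suc d)
  covered : ∀ v → 2 ^ suc d * (if ⌊ v ≟V r ⌋ then 0 else C v)
                  ≤ ∑ (λ h → weight h (agree r v)) * C v
  covered v with v ≟V r
  ... | yes _   = ≤-trans (≤-reflexive (*-zeroʳ (2 ^ suc d))) z≤n
  ... | no  v≢r = *-monoˡ-≤ (C v) (∑-weight-≥ (agree r v) (v≢r ∘ agree≡top⇒≡))

-- The lower bound on the pebbling number

potential : V d → Config d → ℕ
potential r C = ∑ (λ v → C v * 2 ^ card (agree r v))

-- Returning the two removed pebbles turns the truncated subtraction in `step` into an additive
-- identity that can be summed.
step-δ : ∀ (C : Config d) {u v} → Adj u v → 2 ≤ C u → ∀ x →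
         step C u v x + δ u x * 2 ≡ C x + δ v x
step-δ C {u} {v} uv 2≤ x with x ≟V u | x ≟V v
-- Adjacency rules out `u ≡ v`.
... | yes refl | yes refl = contradiction (trans (sym (hamming-refl x)) uv) 0≢1+n
... | yes refl | no _     = trans (m∸n+n≡m 2≤) (sym (+-identityʳ (C x)))
... | no _     | yes _    = trans (+-identityʳ _) (+-comm 1 (C x))
... | no _     | no _     = refl

-- The loss at `u` is `2 * ω u` and the gain at `v` is `ω v`, which is at most `2 * ω u` for
-- neighbours.
potential-step : ∀ (r : V d) {C C'} → PebStep C C' → potential r C' ≤ potential r C
potential-step {d} r {C} (peb u v uv 2≤) = +-cancelʳ-≤ (2 * ω u) _ _ (begin
  potential r (step C u v) + 2 * ω u
    ≡⟨ cong (potential r (step C u v) +_) (sym (∑-δ u (λ x → 2 * ω x))) ⟩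
  potential r (step C u v) + ∑ (λ x → δ u x * (2 * ω x))
    ≡⟨ sym (sumℕ-+ (λ x → step C u v x * ω x) _ (allV d)) ⟩
  ∑ (λ x → step C u v x * ω x + δ u x * (2 * ω x))
    ≡⟨ sumℕ-cong move (allV d) ⟩
  ∑ (λ x → C x * ω x + δ v x * ω x)
    ≡⟨ sumℕ-+ (λ x → C x * ω x) _ (allV d) ⟩
  potential r C + ∑ (λ x → δ v x * ω x)
    ≡⟨ cong (potential r C +_) (∑-δ v ω) ⟩
  potential r C + ω v
    ≤⟨ +-monoʳ-≤ (potential r C) (^-monoʳ-≤ 2 card≤) ⟩
  potential r C + 2 * ω u ∎)
  where
  open ≤-Reasoning
  ω : V d → ℕ
  ω x = 2 ^ card (agree r x)
  card≤ : card (agree r v) ≤ suc (card (agree r u))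
  card≤ = subst (λ k → card (agree r v) ≤ k + card (agree r u))
                (trans (hamming-agree r u v) uv) (card-≤-hamming (agree r u) (agree r v))
  move : ∀ x → step C u v x * ω x + δ u x * (2 * ω x) ≡ C x * ω x + δ v x * ω x
  move x = begin-equality
    step C u v x * ω x + δ u x * (2 * ω x)
      ≡⟨ solve 3 (λ s a w → s :* w :+ a :* (con 2 :* w) := (s :+ a :* con 2) :* w) refl
           (step C u v x) (δ u x) (ω x) ⟩
    (step C u v x + δ u x * 2) * ω x
      ≡⟨ cong (_* ω x) (step-δ C uv 2≤ x) ⟩
    (C x + δ v x) * ω x
      ≡⟨ *-distribʳ-+ (ω x) (C x) (δ v x) ⟩
    C x * ω x + δ v x * ω x ∎

potential-steps : ∀ (r : V d) {C C'} → Star PebStep C C' → potential r C' ≤ potential r C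
potential-steps r ε        = ≤-refl
potential-steps r (s ◅ ss) = ≤-trans (potential-steps r ss) (potential-step r s)

-- A single pebble on `r` has potential `2 ^ d`.
solvable⇒potential≥ : ∀ (r : V d) {C} → Solvable C r → 2 ^ d ≤ potential r C
solvable⇒potential≥ {d} r {C} (C' , steps , 1≤) = begin
  2 ^ d                              ≡⟨ cong (2 ^_) (sym (trans (cong card (agree-self r)) (card-top d))) ⟩
  2 ^ card (agree r r)               ≡⟨ sym (*-identityˡ _) ⟩
  1 * 2 ^ card (agree r r)           ≤⟨ *-monoˡ-≤ (2 ^ card (agree r r)) 1≤ ⟩
  C' r * 2 ^ card (agree r r)        ≤⟨ term≤∑ (λ v → C' v * 2 ^ card (agree r v)) r ⟩
  potential r C'                     ≤⟨ potential-steps r steps ⟩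
  potential r C                      ∎
  where open ≤-Reasoning

-- All `t` pebbles are put on the antipode of `r`, where each has potential `2 ^ 0`, so the
-- potential equals `t`.
2^d≤allSolvable : ∀ d (r : V d) t → AllSolvable d r t → 2 ^ d ≤ t
2^d≤allSolvable d r t solv = subst (2 ^ d ≤_) potential≡t
  (solvable⇒potential≥ r (solv C (∑-δ antipode (λ _ → t))))
  where
  open ≡-Reasoning
  antipode : V d
  antipode = agree r bottom
  C : Config d
  C v = δ antipode v * t
  potential≡t : potential r C ≡ t
  potential≡t = begin
    ∑ (λ v → δ antipode v * t * 2 ^ card (agree r v))
      ≡⟨ sumℕ-cong (λ v → *-assoc (δ antipode v) t _) (allV d) ⟩
    ∑ (λ v → δ antipode v * (t * 2 ^ card (agree r v)))
      ≡⟨ ∑-δ antipode (λ v → t * 2 ^ card (agree r v)) ⟩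
    t * 2 ^ card (agree r antipode)
      ≡⟨ cong (λ k → t * 2 ^ k) (trans (cong card (agree-involutive r bottom)) (card-bottom d)) ⟩
    t * 1
      ≡⟨ *-identityʳ t ⟩
    t ∎

theorem4p2 : (d : ℕ) → 1 ≤ d → (r : V d) → (z t : ℕ) →
    IsZ d r z → IsPebblingNumber d r t → z < 2 * t
theorem4p2 (suc d) _ r _ t ((C , feas , refl) , _) (solv , _) =
  <-≤-trans (feasible⇒objective< r C feas) (*-monoʳ-≤ 2 (2^d≤allSolvable (suc d) r t solv))
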